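{- For every integer $n\ge 3$, $$f(n,\mathcal{B}(2K_2))=2^n-\binom{n}{2}-n-1.$$
   Context: $2K_2$ is the graph consisting of two disjoint edges. For a graph $G$, a hypergraph $H$ is a Berge-$G$ hypergraph if there are an injective map $\phi:V(G)\to V(H)$ and pairwise distinct hyperedges $e_{xy}\in E(H)$, one for each $xy\in E(G)$, with $\phi(x),\phi(y)\in e_{xy}$. $\mathcal{B}(G)$ denotes the family of all Berge-$G$ hypergraphs. For a positive integer $n$ and a graph $G$, $f(n,\mathcal{B}(G))$ is the smallest number of colors in a coloring of all subsets of $[n]=\{1,\dots,n\}$ (i.e. of $2^{[n]}$) such that there is no monochromatic Berge-$G$ hypergraph, i.e. no color class, viewed as a (non-uniform) hypergraph on $[n]$, contains a Berge-$G$ subhypergraph. -}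

module Defs where

open import Level using (0ℓ) renaming (suc to lsuc)
open import Data.Nat.Base using (ℕ; _≤_)
open import Data.Fin.Base using (Fin)
open import Data.Fin.Patterns using (0F; 1F; 2F; 3F)
open import Data.Fin.Subset using (Subset; _∈_; _∪_; ⁅_⁆; ∣_∣)
open import Data.Bool.Properties using () renaming (_≟_ to _≟ᵇ_)
open import Data.Vec.Properties using (≡-dec)
open import Data.Product.Base using (_×_; ∃-syntax)
open import Data.Sum.Base using (_⊎_; inj₁; inj₂)
open import Function.Definitions using (Injective)
open import Relation.Nullary using (¬_; _⊎-dec_)
open import Relation.Unary using (Pred; Decidable; _⊆_)
open import Relation.Binary.PropositionalEquality using (_≡_; refl)

-- A finite simple graph on the vertices Fin order; an edge xy is the
-- two-element set {x , y}.
record Graph : Set₁ where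
  field
    order    : ℕ
    Edge     : Pred (Subset order) 0ℓ
    edge?    : Decidable Edge
    edgeSize : ∀ {xy} → Edge xy → ∣ xy ∣ ≡ 2

2K₂ : Graph
2K₂ = record
  { order    = 4
  ; Edge     = λ xy → (xy ≡ ⁅ 0F ⁆ ∪ ⁅ 1F ⁆) ⊎ (xy ≡ ⁅ 2F ⁆ ∪ ⁅ 3F ⁆)
  ; edge?    = λ xy → ≡-dec _≟ᵇ_ xy _ ⊎-dec ≡-dec _≟ᵇ_ xy _
  ; edgeSize = λ { (inj₁ refl) → refl ; (inj₂ refl) → refl }
  }

-- A (not necessarily uniform) hypergraph on [n], given by its hyperedges.
Hypergraph : ℕ → Set₁
Hypergraph n = Pred (Subset n) 0ℓ

record IsBerge (G : Graph) {n : ℕ} (H : Hypergraph n) : Set where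
  open Graph G
  field
    φ           : Fin order → Fin n
    φ-injective : Injective _≡_ _≡_ φ
    -- Only the values of e on edges of G matter.
    e           : Subset order → Subset n
    e-hyperedge : ∀ {xy} → Edge xy → H (e xy)
    e-distinct  : ∀ {xy uv} → Edge xy → Edge uv → e xy ≡ e uv → xy ≡ uv
    e-contains  : ∀ {xy} → Edge xy → ∀ {v} → v ∈ xy → φ v ∈ e xy

Coloring : ℕ → ℕ → Set
Coloring n k = Subset n → Fin k

colorClass : ∀ {n k} → Coloring n k → Fin k → Hypergraph n
colorClass c i A = c A ≡ i

MonochromaticBerge : (G : Graph) → ∀ {n k} → Coloring n k → Set₁
MonochromaticBerge G {n} c =
  ∃[ i ] ∃[ H ] (H ⊆ colorClass c i) × IsBerge G {n} H

Colorable : ℕ → Graph → ℕ → Set₁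
Colorable n G k = ∃[ c ] ¬ MonochromaticBerge G {n} {k} c

-- f(n,𝓑(G)) = k.  This is a relation rather than a function of n and G because
-- for some G (for example a single edge, n ≥ 2) no coloring is admissible.
f[_,𝓑_]≔_ : ℕ → Graph → ℕ → Set₁
f[ n ,𝓑 G ]≔ k = Colorable n G k × (∀ m → Colorable n G m → k ≤ m)

{-# OPTIONS --safe #-}
module Submission where

-- Two distinct sets of size at least 3 always contain disjoint pairs, so they need
-- different colors; this gives the lower bound.  Conversely, color the sets of size
-- at least 3 differently and give every smaller set the color of a 3-set containing
-- it: the members of a color class then lie in a common 3-set or coincide.

open import Data.Nat using (ℕ; zero; suc; pred; _+_; _∸_; _^_; _≤_; _<_; _≥_; z≤n; s≤s; _≤?_; _≟_)
open import Data.Nat.Combinatorics using (_C_; nC1≡n; nCk+nC[k+1]≡[n+1]C[k+1])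
open import Data.Nat.Properties
  using (≤-reflexive; ≤-trans; ≤-pred; <⇒≱; <⇒≤; ≰⇒≥; m≤n⇒m≤1+n; ≤∧≢⇒<; +-suc; +-assoc; +-identityʳ; m+n∸n≡m)
open import Data.Nat.Solver using (module +-*-Solver)
open import Data.Empty using (⊥)
open import Data.Fin.Base using (Fin; zero; suc)
open import Data.Fin.Patterns using (0F; 1F; 2F; 3F)
open import Data.Fin.Properties using (suc-injective; injective⇒≤)
open import Data.Fin.Subset
  using (Subset; inside; outside; _∈_; _∉_; _⊆_; _⊈_; _∪_; _-_; ⊤; ⁅_⁆; ∣_∣)
open import Data.Fin.Subset.Properties
  using ( _⊆?_; ⊆-antisym; ⊆-max; ∣⊤∣≡n; ∣⁅x⁆∣≡1; p⊆q⇒∣p∣≤∣q∣; x∈⁅x⁆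
        ; p⊆p∪q; q⊆p∪q; x∈p∧x≢y⇒x∈p-y; x∈p⇒∣p-x∣<∣p∣; s⊆s; drop-there)
open import Data.List.Base using (List; []; _∷_; [_]; _++_; map; length; lookup)
open import Data.List.Properties using (length-++; length-map)
open import Data.List.Membership.Propositional using () renaming (_∈_ to _∈ˡ_)
open import Data.List.Membership.Propositional.Properties
  using (∈-map⁺; ∈-map⁻; ∈-++⁺ˡ; ∈-++⁺ʳ; ∈-lookup)
import Data.List.Membership.Setoid.Properties as Membership
open import Data.List.Relation.Unary.All as All using (All; []; _∷_)
import Data.List.Relation.Unary.All.Properties as All
open import Data.List.Relation.Unary.Any using (here; there; index)
open import Data.List.Relation.Unary.AllPairs using ([]; _∷_)
open import Data.List.Relation.Unary.Unique.Propositional using (Unique)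
import Data.List.Relation.Unary.Unique.Propositional.Properties as Unique
open import Data.Product.Base using (_×_; _,_; ∃-syntax)
open import Data.Sum.Base using (_⊎_; inj₁; inj₂)
open import Data.Vec.Base using ([]; _∷_; here; there)
open import Data.Vec.Properties using (∷-injectiveʳ)
open import Function.Base using (_∘_; id; case_of_)
open import Function.Definitions using (Injective)
open import Relation.Nullary using (¬_; yes; no; contradiction)
open import Relation.Nullary.Decidable using (decidable-stable)
open import Relation.Binary.PropositionalEquality
  using (_≡_; _≢_; refl; sym; trans; cong; cong₂; subst; setoid; module ≡-Reasoning)
open import Defs

-- Finite subsets: sizes, witnesses and supersets

∣p∪q∣≤∣p∣+∣q∣ : ∀ {n} (p q : Subset n) → ∣ p ∪ q ∣ ≤ ∣ p ∣ + ∣ q ∣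
∣p∪q∣≤∣p∣+∣q∣ []            []            = z≤n
∣p∪q∣≤∣p∣+∣q∣ (outside ∷ p) (outside ∷ q) = ∣p∪q∣≤∣p∣+∣q∣ p q
∣p∪q∣≤∣p∣+∣q∣ (outside ∷ p) (inside  ∷ q) =
  ≤-trans (s≤s (∣p∪q∣≤∣p∣+∣q∣ p q)) (≤-reflexive (sym (+-suc _ _)))
∣p∪q∣≤∣p∣+∣q∣ (inside  ∷ p) (outside ∷ q) = s≤s (∣p∪q∣≤∣p∣+∣q∣ p q)
∣p∪q∣≤∣p∣+∣q∣ (inside  ∷ p) (inside  ∷ q) =
  s≤s (≤-trans (m≤n⇒m≤1+n (∣p∪q∣≤∣p∣+∣q∣ p q)) (≤-reflexive (sym (+-suc _ _))))

∈∧∉⇒≢ : ∀ {n} {p : Subset n} {x y} → x ∈ p → y ∉ p → x ≢ y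
∈∧∉⇒≢ x∈p y∉p refl = y∉p x∈p

-- Scanning the bits in parallel makes this constructive: the witness is the first position inside
-- `p` and outside `q`.
p⊈q⇒∃∈p∉q : ∀ {n} {p q : Subset n} → p ⊈ q → ∃[ x ] x ∈ p × x ∉ q
p⊈q⇒∃∈p∉q {p = []}          {[]}          p⊈q with () ← p⊈q id
p⊈q⇒∃∈p∉q {p = inside  ∷ p} {outside ∷ q} p⊈q = zero , here , λ ()
p⊈q⇒∃∈p∉q {p = inside  ∷ p} {inside  ∷ q} p⊈q =
  let x , x∈p , x∉q = p⊈q⇒∃∈p∉q {p = p} {q} (λ p⊆q → p⊈q (s⊆s p⊆q))
  in  suc x , there x∈p , x∉q ∘ drop-there
p⊈q⇒∃∈p∉q {p = outside ∷ p} {_ ∷ q}       p⊈q =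
  let x , x∈p , x∉q = p⊈q⇒∃∈p∉q {p = p} {q} (λ p⊆q → p⊈q (λ { (there x∈p) → there (p⊆q x∈p) }))
  in  suc x , there x∈p , x∉q ∘ drop-there

∣q∣<∣p∣⇒∃∈p∉q : ∀ {n} {p q : Subset n} → ∣ q ∣ < ∣ p ∣ → ∃[ x ] x ∈ p × x ∉ q
∣q∣<∣p∣⇒∃∈p∉q q<p = p⊈q⇒∃∈p∉q (λ p⊆q → <⇒≱ q<p (p⊆q⇒∣p∣≤∣q∣ p⊆q))

-- Pigeonhole by induction on `k`: by injectivity the other values avoid `f zero`, so they lie in
-- `p - f zero`, which is strictly smaller than `p`.
injective⇒≤∣p∣ : ∀ {k n} {f : Fin k → Fin n} (p : Subset n) →
                 Injective _≡_ _≡_ f → (∀ i → f i ∈ p) → k ≤ ∣ p ∣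
injective⇒≤∣p∣ {zero}          p inj f∈p = z≤n
injective⇒≤∣p∣ {suc k} {f = f} p inj f∈p = ≤-trans
  (s≤s (injective⇒≤∣p∣ (p - f zero) (suc-injective ∘ inj)
    (λ i → x∈p∧x≢y⇒x∈p-y (f∈p (suc i)) (λ eq → case inj {suc i} {zero} eq of λ ()))))
  (x∈p⇒∣p-x∣<∣p∣ (f∈p zero))

-- An element outside `p` is left out as long as the remaining elements suffice to reach size `k`;
-- once `k` equals the size of the ground set, the full set is the answer.
superset : ∀ {n k} (p : Subset n) → ∣ p ∣ ≤ k → k ≤ n → ∃[ q ] p ⊆ q × ∣ q ∣ ≡ k
superset [] z≤n z≤n = [] , id , refl
superset (inside ∷ p) (s≤s p≤k) (s≤s k≤n) =
  let q , p⊆q , q≡k = superset p p≤k k≤n in inside ∷ q , s⊆s p⊆q , cong suc q≡k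
superset {suc n} {k} (outside ∷ p) p≤k k≤1+n with k ≟ suc n
... | yes refl = ⊤ , ⊆-max _ , ∣⊤∣≡n (suc n)
... | no  k≢1+n =
  let q , p⊆q , q≡k = superset p p≤k (≤-pred (≤∧≢⇒< k≤1+n k≢1+n)) in outside ∷ q , s⊆s p⊆q , q≡k

-- Listing and counting the sets of size at least k

subsets≥ : ∀ n → ℕ → List (Subset n)
subsets≥ zero    zero    = [ [] ]
subsets≥ zero    (suc k) = []
-- `pred` keeps the threshold 0 at 0, so that `subsets≥ n 0` is the whole power set.
subsets≥ (suc n) k       = map (inside ∷_) (subsets≥ n (pred k)) ++ map (outside ∷_) (subsets≥ n k)

∈-subsets≥⁺ : ∀ {n k} (p : Subset n) → k ≤ ∣ p ∣ → p ∈ˡ subsets≥ n k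
∈-subsets≥⁺ []            z≤n       = here refl
∈-subsets≥⁺ (inside  ∷ p) z≤n       = ∈-++⁺ˡ (∈-map⁺ (inside ∷_) (∈-subsets≥⁺ p z≤n))
∈-subsets≥⁺ (inside  ∷ p) (s≤s k≤p) = ∈-++⁺ˡ (∈-map⁺ (inside ∷_) (∈-subsets≥⁺ p k≤p))
∈-subsets≥⁺ {suc n} {k} (outside ∷ p) k≤p =
  ∈-++⁺ʳ (map (inside ∷_) (subsets≥ n (pred k))) (∈-map⁺ (outside ∷_) (∈-subsets≥⁺ p k≤p))

k≤∣subsets≥∣ : ∀ n k → All (λ p → k ≤ ∣ p ∣) (subsets≥ n k)
k≤∣subsets≥∣ zero    zero    = z≤n ∷ []
k≤∣subsets≥∣ zero    (suc k) = []
k≤∣subsets≥∣ (suc n) zero    = All.universal (λ _ → z≤n) _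
k≤∣subsets≥∣ (suc n) (suc k) =
  All.++⁺ (All.map⁺ (All.map s≤s (k≤∣subsets≥∣ n k))) (All.map⁺ (k≤∣subsets≥∣ n (suc k)))

subsets≥-unique : ∀ n k → Unique (subsets≥ n k)
subsets≥-unique zero    zero    = [] ∷ []
subsets≥-unique zero    (suc k) = []
subsets≥-unique (suc n) k       = Unique.++⁺
  (Unique.map⁺ ∷-injectiveʳ (subsets≥-unique n (pred k)))
  (Unique.map⁺ ∷-injectiveʳ (subsets≥-unique n k))
  -- A common member would begin with both `inside` and `outside`.
  (λ (∈in , ∈out) → case (∈-map⁻ _ ∈in , ∈-map⁻ _ ∈out) of
    λ { ((_ , _ , refl) , (_ , _ , ())) })

length-subsets≥-suc : ∀ n k → length (subsets≥ (suc n) k) ≡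
                      length (subsets≥ n (pred k)) + length (subsets≥ n k)
length-subsets≥-suc n k = trans
  (length-++ (map (inside ∷_) (subsets≥ n (pred k))))
  (cong₂ _+_ (length-map _ (subsets≥ n (pred k))) (length-map _ (subsets≥ n k)))

length-subsets≥-0 : ∀ n → length (subsets≥ n 0) ≡ 2 ^ n
length-subsets≥-0 zero    = refl
length-subsets≥-0 (suc n) rewrite length-subsets≥-suc n 0 | length-subsets≥-0 n =
  cong (2 ^ n +_) (sym (+-identityʳ _))

-- Lowering the threshold from `suc k` to `k` adds exactly the sets of size `k`. The induction is
-- Pascal's rule; the additive form avoids truncated subtraction.
length-subsets≥-C : ∀ n k → length (subsets≥ n (suc k)) + n C k ≡ length (subsets≥ n k)
length-subsets≥-C zero    zero    = refl
length-subsets≥-C zero    (suc k) = refl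
length-subsets≥-C (suc n) zero
  rewrite length-subsets≥-suc n 1 | length-subsets≥-suc n 0 =
  trans (+-assoc (length (subsets≥ n 0)) _ 1) (cong (length (subsets≥ n 0) +_) (length-subsets≥-C n 0))
length-subsets≥-C (suc n) (suc k)
  rewrite length-subsets≥-suc n (suc (suc k)) | length-subsets≥-suc n (suc k)
        | sym (nCk+nC[k+1]≡[n+1]C[k+1] n k)
        | sym (length-subsets≥-C n k) = begin
  -- The rewrites have turned `length (subsets≥ n k)` into `a + n C k`, so only the induction
  -- hypothesis at `suc k` remains to be used.
  a + b + (n C k + n C suc k)    ≡⟨ solve 4 (λ a b c d → a :+ b :+ (c :+ d) := a :+ c :+ (b :+ d)) refl a b (n C k) (n C suc k) ⟩
  a + n C k + (b + n C suc k)    ≡⟨ cong (a + n C k +_) (length-subsets≥-C n (suc k)) ⟩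
  a + n C k + a                  ∎
  where
  open ≡-Reasoning
  open +-*-Solver
  a = length (subsets≥ n (suc k))
  b = length (subsets≥ n (suc (suc k)))

-- Lowering the threshold from 3 to 0 in three steps writes `2 ^ n` as `l + n C 2 + n + 1`, so each
-- truncated subtraction cancels a summand exactly.
length-subsets≥-3 : ∀ n → length (subsets≥ n 3) ≡ 2 ^ n ∸ (n C 2) ∸ n ∸ 1
length-subsets≥-3 n
  rewrite sym (length-subsets≥-0 n) | sym (length-subsets≥-C n 0)
        | sym (length-subsets≥-C n 1) | sym (length-subsets≥-C n 2) | nC1≡n n = sym (begin
  l + n C 2 + n + 1 ∸ n C 2 ∸ n ∸ 1
    ≡⟨ cong (λ m → m ∸ n C 2 ∸ n ∸ 1)
         (solve 3 (λ a b c → a :+ b :+ c :+ con 1 := a :+ con 1 :+ c :+ b) refl l (n C 2) n) ⟩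
  l + 1 + n + n C 2 ∸ n C 2 ∸ n ∸ 1
    ≡⟨ cong (λ m → m ∸ n ∸ 1) (m+n∸n≡m (l + 1 + n) (n C 2)) ⟩
  l + 1 + n ∸ n ∸ 1
    ≡⟨ cong (_∸ 1) (m+n∸n≡m (l + 1) n) ⟩
  l + 1 ∸ 1
    ≡⟨ m+n∸n≡m l 1 ⟩
  l ∎)
  where
  open ≡-Reasoning
  open +-*-Solver
  l = length (subsets≥ n 3)

-- Lower bound: large sets need pairwise different colors

lookup-injective : ∀ {a} {A : Set a} {xs : List A} → Unique xs → Injective _≡_ _≡_ (lookup xs)
lookup-injective (_  ∷ _) {zero}  {zero}  _  = refl
lookup-injective (x≢ ∷ _) {zero}  {suc j} eq = contradiction eq (All.lookup x≢ (∈-lookup j))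
lookup-injective (x≢ ∷ _) {suc i} {zero}  eq = contradiction (sym eq) (All.lookup x≢ (∈-lookup i))
lookup-injective (_  ∷ u) {suc i} {suc j} eq = cong suc (lookup-injective u eq)

module _ {n} {p q : Subset n} where

  private
    disjointEdges : ∀ {x y u v} → x ∈ p → y ∈ p → u ∈ q → v ∈ q →
      x ≢ y → x ≢ u → x ≢ v → y ≢ u → y ≢ v → u ≢ v → p ≢ q →
      IsBerge 2K₂ (λ r → r ≡ p ⊎ r ≡ q)
    disjointEdges {x} {y} {u} {v} x∈p y∈p u∈q v∈q x≢y x≢u x≢v y≢u y≢v u≢v p≢q = record
      { φ           = φ
      ; φ-injective = φ-injective _ _
      ; e           = e
      ; e-hyperedge = λ { (inj₁ refl) → inj₁ refl ; (inj₂ refl) → inj₂ refl }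
      ; e-distinct  = λ
        { (inj₁ refl) (inj₁ refl) _  → refl
        ; (inj₁ refl) (inj₂ refl) eq → contradiction eq p≢q
        ; (inj₂ refl) (inj₁ refl) eq → contradiction (sym eq) p≢q
        ; (inj₂ refl) (inj₂ refl) _  → refl
        }
      ; e-contains  = λ
        { (inj₁ refl) {0F} _ → x∈p
        ; (inj₁ refl) {1F} _ → y∈p
        ; (inj₁ refl) {2F} (there (there ()))
        ; (inj₁ refl) {3F} (there (there (there ())))
        ; (inj₂ refl) {2F} _ → u∈q
        ; (inj₂ refl) {3F} _ → v∈q
        ; (inj₂ refl) {0F} ()
        ; (inj₂ refl) {1F} (there ())
        }
      }
      where
      φ : Fin 4 → Fin n
      φ 0F = x
      φ 1F = y
      φ 2F = u
      φ 3F = v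

      φ-injective : ∀ i j → φ i ≡ φ j → i ≡ j
      φ-injective 0F 0F _  = refl
      φ-injective 0F 1F eq = contradiction eq x≢y
      φ-injective 0F 2F eq = contradiction eq x≢u
      φ-injective 0F 3F eq = contradiction eq x≢v
      φ-injective 1F 0F eq = contradiction (sym eq) x≢y
      φ-injective 1F 1F _  = refl
      φ-injective 1F 2F eq = contradiction eq y≢u
      φ-injective 1F 3F eq = contradiction eq y≢v
      φ-injective 2F 0F eq = contradiction (sym eq) x≢u
      φ-injective 2F 1F eq = contradiction (sym eq) y≢u
      φ-injective 2F 2F _  = refl
      φ-injective 2F 3F eq = contradiction eq u≢v
      φ-injective 3F 0F eq = contradiction (sym eq) x≢v
      φ-injective 3F 1F eq = contradiction (sym eq) y≢v
      φ-injective 3F 2F eq = contradiction (sym eq) u≢v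
      φ-injective 3F 3F _  = refl

      -- The bit of vertex `0F` alone tells the two edges of `2K₂` apart.
      e : Subset 4 → Subset n
      e (inside  ∷ _) = p
      e (outside ∷ _) = q

  -- Pick v ∈ q ∖ p, then u ∈ q other than v, then x, y ∈ p other than u.
  q⊈p⇒berge : 3 ≤ ∣ p ∣ → 2 ≤ ∣ q ∣ → q ⊈ p → IsBerge 2K₂ (λ r → r ≡ p ⊎ r ≡ q)
  q⊈p⇒berge 3≤p 2≤q q⊈p =
    let v , v∈q , v∉p  = p⊈q⇒∃∈p∉q q⊈p
        u , u∈q , u∉v  = ∣q∣<∣p∣⇒∃∈p∉q (subst (_< ∣ q ∣) (sym (∣⁅x⁆∣≡1 v)) 2≤q)
        x , x∈p , x∉u  = ∣q∣<∣p∣⇒∃∈p∉q (subst (_< ∣ p ∣) (sym (∣⁅x⁆∣≡1 u)) (<⇒≤ 3≤p))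
        y , y∈p , y∉ux = ∣q∣<∣p∣⇒∃∈p∉q (≤-trans (s≤s (∣⁅u⁆∪⁅x⁆∣≤2 u x)) 3≤p)
    in  disjointEdges x∈p y∈p u∈q v∈q
          (∈∧∉⇒≢ (q⊆p∪q ⁅ u ⁆ ⁅ x ⁆ (x∈⁅x⁆ x)) y∉ux)
          (∈∧∉⇒≢ (x∈⁅x⁆ u) x∉u ∘ sym)
          (∈∧∉⇒≢ x∈p v∉p)
          (∈∧∉⇒≢ (p⊆p∪q ⁅ x ⁆ (x∈⁅x⁆ u)) y∉ux ∘ sym)
          (∈∧∉⇒≢ y∈p v∉p)
          (∈∧∉⇒≢ (x∈⁅x⁆ v) u∉v ∘ sym)
          (λ { refl → q⊈p id })
    where
    ∣⁅u⁆∪⁅x⁆∣≤2 : ∀ (u x : Fin n) → ∣ ⁅ u ⁆ ∪ ⁅ x ⁆ ∣ ≤ 2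
    ∣⁅u⁆∪⁅x⁆∣≤2 u x = ≤-trans (∣p∪q∣≤∣p∣+∣q∣ ⁅ u ⁆ ⁅ x ⁆)
      (≤-reflexive (cong₂ _+_ (∣⁅x⁆∣≡1 u) (∣⁅x⁆∣≡1 x)))

-- If either inclusion failed, the two sets by themselves would be a Berge copy inside their common
-- color class. Inclusion is decidable, so refuting its failure proves it.
colors-distinct : ∀ {n k} {c : Coloring n k} → ¬ MonochromaticBerge 2K₂ c →
                  ∀ {p q} → 3 ≤ ∣ p ∣ → 3 ≤ ∣ q ∣ → c p ≡ c q → p ≡ q
colors-distinct {c = c} ¬mono {p} {q} 3≤p 3≤q cp≡cq = ⊆-antisym
  (decidable-stable (p ⊆? q) λ p⊈q →
    ¬mono (c p , _ , (λ { (inj₁ refl) → sym cp≡cq ; (inj₂ refl) → refl }) , q⊈p⇒berge 3≤q (<⇒≤ 3≤p) p⊈q))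
  (decidable-stable (q ⊆? p) λ q⊈p →
    ¬mono (c p , _ , (λ { (inj₁ refl) → refl ; (inj₂ refl) → sym cp≡cq }) , q⊈p⇒berge 3≤p (<⇒≤ 3≤q) q⊈p))

-- Restricted to the listed sets, an admissible coloring is an injection from list positions into
-- colors.
colorable⇒length≤ : ∀ {n m} → Colorable n 2K₂ m → length (subsets≥ n 3) ≤ m
colorable⇒length≤ {n} (c , ¬mono) = injective⇒≤ {f = c ∘ lookup (subsets≥ n 3)}
  (λ {i} {j} eq → lookup-injective (subsets≥-unique n 3) (colors-distinct ¬mono (3≤ i) (3≤ j) eq))
  where
  3≤ : ∀ i → 3 ≤ ∣ lookup (subsets≥ n 3) i ∣
  3≤ i = All.lookup (k≤∣subsets≥∣ n 3) (∈-lookup i)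

-- Upper bound: coloring by an enlargement to size at least 3

record Enlargement {n} (p : Subset n) : Set where
  field
    set   : Subset n
    p⊆set : p ⊆ set
    3≤set : 3 ≤ ∣ set ∣
    -- Either the enlarged set is too small to hold four vertices, or nothing was added and `p` can
    -- be recovered from it.
    tight : ∣ set ∣ ≤ 3 ⊎ p ≡ set

open Enlargement

module _ {n} (3≤n : 3 ≤ n) where

  enlarge : (p : Subset n) → Enlargement p
  enlarge p with 3 ≤? ∣ p ∣
  ... | yes 3≤p = record { set = p ; p⊆set = id ; 3≤set = 3≤p ; tight = inj₂ refl }
  ... | no  3≰p =
    let q , p⊆q , q≡3 = superset p (≰⇒≥ 3≰p) 3≤n
    in  record { set = q ; p⊆set = p⊆q ; 3≤set = ≤-reflexive (sym q≡3) ; tight = inj₁ (≤-reflexive q≡3) }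

  ⌈_⌉ : Subset n → Subset n
  ⌈ p ⌉ = set (enlarge p)

  ⌈_⌉∈ : ∀ p → ⌈ p ⌉ ∈ˡ subsets≥ n 3
  ⌈ p ⌉∈ = ∈-subsets≥⁺ ⌈ p ⌉ (3≤set (enlarge p))

  -- A color is the position of the enlarged set in the list, so equal colors mean equal enlarged
  -- sets and the list length is the number of colors.
  coloring : Coloring n (length (subsets≥ n 3))
  coloring p = index ⌈ p ⌉∈

  coloring-⌈⌉ : ∀ p q → coloring p ≡ coloring q → ⌈ p ⌉ ≡ ⌈ q ⌉
  coloring-⌈⌉ p q = Membership.index-injective (setoid _) ⌈ p ⌉∈ ⌈ q ⌉∈

  -- A color class consists of subsets of one set d, where either ∣d∣ = 3, which
  -- leaves no room for the four vertices, or d is the only member.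
  coloring-¬mono : ¬ MonochromaticBerge 2K₂ coloring
  coloring-¬mono (i , H , H⊆ , berge) = absurd
    where
    open IsBerge berge
    a b : Subset n
    a = e (⁅ 0F ⁆ ∪ ⁅ 1F ⁆)
    b = e (⁅ 2F ⁆ ∪ ⁅ 3F ⁆)

    ⌈a⌉≡⌈b⌉ : ⌈ a ⌉ ≡ ⌈ b ⌉
    ⌈a⌉≡⌈b⌉ = coloring-⌈⌉ a b (trans (H⊆ (e-hyperedge (inj₁ refl))) (sym (H⊆ (e-hyperedge (inj₂ refl)))))

    a⊆ : a ⊆ ⌈ a ⌉
    a⊆ = p⊆set (enlarge a)

    b⊆ : b ⊆ ⌈ a ⌉
    b⊆ = subst (b ⊆_) (sym ⌈a⌉≡⌈b⌉) (p⊆set (enlarge b))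

    φ∈⌈a⌉ : ∀ v → φ v ∈ ⌈ a ⌉
    φ∈⌈a⌉ 0F = a⊆ (e-contains (inj₁ refl) here)
    φ∈⌈a⌉ 1F = a⊆ (e-contains (inj₁ refl) (there here))
    φ∈⌈a⌉ 2F = b⊆ (e-contains (inj₂ refl) (there (there here)))
    φ∈⌈a⌉ 3F = b⊆ (e-contains (inj₂ refl) (there (there (there here))))

    4≤∣⌈a⌉∣ : 4 ≤ ∣ ⌈ a ⌉ ∣
    4≤∣⌈a⌉∣ = injective⇒≤∣p∣ ⌈ a ⌉ φ-injective φ∈⌈a⌉

    absurd : ⊥
    absurd with tight (enlarge a) | tight (enlarge b)
    ... | inj₁ ≤3 | _       = <⇒≱ 4≤∣⌈a⌉∣ ≤3
    ... | inj₂ _  | inj₁ ≤3 = <⇒≱ 4≤∣⌈a⌉∣ (subst (λ d → ∣ d ∣ ≤ 3) (sym ⌈a⌉≡⌈b⌉) ≤3)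
    -- Both hyperedges equal the common enlarged set, so `e-distinct` would identify the two
    -- disjoint edges of `2K₂`.
    ... | inj₂ a≡ | inj₂ b≡ =
      case e-distinct (inj₁ refl) (inj₂ refl) (trans a≡ (trans ⌈a⌉≡⌈b⌉ (sym b≡))) of λ ()

theorem3 : (n : ℕ) → n ≥ 3 → f[ n ,𝓑 2K₂ ]≔ (2 ^ n ∸ (n C 2) ∸ n ∸ 1)
theorem3 n n≥3 = subst (f[ n ,𝓑 2K₂ ]≔_) (length-subsets≥-3 n)
  ((coloring n≥3 , coloring-¬mono n≥3) , λ _ → colorable⇒length≤)
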